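{- Let $D$ be a vf-safe delta-matroid with ground set $[n]$, let $(U,\Omega)$ be an $(n,3)$-carrier, let $\tau=(T_1,T_2,T_3)$ be a transversal $3$-tuple of $(U,\Omega)$, and let $\sigma:U\to[n]$ be a projection of $(U,\Omega)$. Then $$\operatorname{Orb}(D)=\{D' \mid \exists\,\tau'\in\mathbb{T}_{(U,\Omega)}\text{ and }\sigma'\in\mathbb{P}_{(U,\Omega)}\text{ such that } Z_{D',\tau',\sigma'}=Z_{D,\tau,\sigma}\},$$ where $D'$ ranges over vf-safe delta-matroids with ground set $[n]$.
   Context: Set systems and the group action. A set system on $[n]=\{1,\dots,n\}$ is a pair $D=([n],\mathcal{F})$, $\mathcal{F}=\mathcal{F}(D)$ a collection of subsets of $[n]$ (feasible sets). It is a delta-matroid if $\mathcal{F}\ne\emptyset$ and for all $X,Y\in\mathcal{F}$ and $u\in X\triangle Y$ there is $v\in X\triangle Y$ (possibly $v=u$) with $X\triangle\{u,v\}\in\mathcal{F}$. For $i\in[n]$: $D\ast i=([n],\{X\triangle\{i\}:X\in\mathcal{F}\})$ and $D+i=([n],\mathcal{F}\triangle\{I\cup\{i\}:I\in\mathcal{F},i\notin I\})$. For fixed $i$ these satisfy the relations of $\mathcal{G}=\langle\ast,+\mid\ast^2,+^2,(\ast+)^3\rangle\cong S_3$; write $\overline{\ast}=+\ast+=\ast+\ast$. For a word $g=g_1\cdots g_k$, $D\,g\,i:=(\cdots(D\,g_k\,i)\cdots)g_1\,i$. Operations on distinct elements commute. For $\hat g=(g_1,\dots,g_n)\in\mathcal{G}^n$,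 $\hat g\cdot D$ is obtained by applying $g_i$ to $i$ for all $i$. For $I\subseteq[n]$, $D\overline{\ast}I$ applies $\overline{\ast}$ to every element of $I$; equivalently, $X\in\mathcal{F}(D\overline{\ast}I)$ iff $|\{Y\in\mathcal{F}(D): X\subseteq Y\subseteq X\cup I\}|$ is odd. $D$ is vf-safe if $\hat g\cdot D$ is a delta-matroid for all $\hat g\in\mathcal{G}^n$. For $\pi\in S_n$, $D_\pi=([n],\{\pi(I):I\in\mathcal{F}\})$. The semidirect product $\mathcal{G}^n\rtimes_\phi S_n$, with $(\hat g,\pi_1)(\hat h,\pi_2)=(\hat g\circ\hat h\pi_1^{ -1},\pi_1\pi_2)$, $\circ$ componentwise, $(\hat h\pi^{ -1})(i)=h_{\pi^{ -1}(i)}$, acts on set systems by $(\hat g,\pi)D=\hat g\cdot D_\pi$; $\operatorname{Orb}(D)$ is the orbit of $D$. Carriers and lifts. An $(n,3)$-carrier is a pair $(U,\Omega)$ with $\Omega$ a partition of a finite set $U$ into $n$ classes (skew classes), each of size $3$. A transversal of $\Omega$ is a subset of $U$ meeting each class in exactly one element; $\mathcal{T}(\Omega)$ is the set of transversals. A transversal $3$-tuple is an ordered triple $(T_1,T_2,T_3)$ of mutually disjoint transversals with union $U$; $\mathbb{T}_{(U,\Omega)}$ is the set of them. A projection is a surjection $\sigma:U\to[n]$ with $\sigma(x)=\sigma(y)$ iff $x,y$ lie in the same skew class; $\mathbb{P}_{(U,\Omega)}$ is the set of them. For a vf-safe delta-matroid $D$ on $[n]$, $\tau=(T_1,T_2,T_3)$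 and $\sigma$, let $$\mathcal{B}_{D,\tau,\sigma}=\{B\in\mathcal{T}(\Omega)\mid \sigma(B\cap T_2)\in\mathcal{F}(D\,\overline{\ast}\,\sigma(B\cap T_3))\}$$ and $Z_{D,\tau,\sigma}=(U,\Omega,\mathcal{B}_{D,\tau,\sigma}^*)$, where $\mathcal{B}^*=\{I\mid I\subseteq B\text{ for some }B\in\mathcal{B}\}$. This is a tight $3$-matroid with set of bases $\mathcal{B}_{D,\tau,\sigma}$, called the lift of $D$. -}

module Defs where

open import Data.Bool using (Bool; _xor_; T; T?; if_then_else_)
import Data.Bool.Properties as Bool
open import Data.Fin using (Fin; _≟_)
open import Data.Fin.Permutation using (Permutation′; _⟨$⟩ʳ_)
open import Data.Fin.Properties using (any?)
open import Data.Fin.Subset using (Subset; _∈_; _∉_; _⊆_; _∩_; _∪_; ⁅_⁆; ∣_∣; Empty; ⊤)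
open import Data.Fin.Subset.Properties using (_∈?_; anySubset?)
open import Data.List using (List; []; _∷_; foldr; allFin)
open import Data.Nat using (ℕ)
open import Data.Product using (∃; ∃!; _×_; _,_)
open import Data.Vec using (tabulate; zipWith; lookup)
open import Data.Vec.Properties using (≡-dec)
open import Function.Bundles using (_⇔_)
open import Function.Definitions using (Surjective)
open import Level using (0ℓ)
open import Relation.Binary.Definitions using (DecidableEquality)
open import Relation.Binary.PropositionalEquality using (_≡_; _≗_)
open import Relation.Nullary using (does; ¬?)
open import Relation.Nullary.Decidable using (_×-dec_)
open import Relation.Unary using (Pred)

private
  variable
    m n : ℕ

infixl 6 _△_

_△_ : Subset n → Subset n → Subset n
_△_ = zipWith _xor_

_≟ˢ_ : DecidableEquality (Subset n)
_≟ˢ_ = ≡-dec Bool._≟_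

-- The image { f x | x ∈ S }.
_⟦_⟧ : (Fin m → Fin n) → Subset m → Subset n
f ⟦ S ⟧ = tabulate λ j → does (any? λ x → (x ∈? S) ×-dec (f x ≟ j))

-- A set system on [n] is given by the characteristic function of its collection
-- of feasible sets; equality of set systems is therefore pointwise equality _≗_.
SetSystem : ℕ → Set
SetSystem n = Subset n → Bool

Feasible : SetSystem n → Pred (Subset n) 0ℓ
Feasible D X = T (D X)

-- The set system { f X | X feasible in D }.
image : (Subset m → Subset n) → SetSystem m → SetSystem n
image f D Y = does (anySubset? λ X → T? (D X) ×-dec (f X ≟ˢ Y))

record IsDeltaMatroid (D : SetSystem n) : Set where
  field
    nonempty : ∃ λ X → Feasible D X
    exchange : ∀ X Y → Feasible D X → Feasible D Y → ∀ u → u ∈ X △ Y →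
               ∃ λ v → v ∈ X △ Y × Feasible D (X △ (⁅ u ⁆ ∪ ⁅ v ⁆))

data Generator : Set where
  ⋆ ⊹ : Generator

-- D ∗ i
twist : SetSystem n → Fin n → SetSystem n
twist D i = image (_△ ⁅ i ⁆) D

-- D + i
loopComplement : SetSystem n → Fin n → SetSystem n
loopComplement D i X = D X xor image (_∪ ⁅ i ⁆) D∖i X
  where
  D∖i : SetSystem _
  D∖i I = does (T? (D I) ×-dec ¬? (i ∈? I))

-- Elements of ⟨ ∗ , + ∣ ∗² , +² , (∗+)³ ⟩ are represented by words. The generators
-- are their own inverses, so every element has such a representative, and words
-- equal in the group act equally; quantifying over words is thus the same as
-- quantifying over group elements.
𝒢 : Set
𝒢 = List Generator

apply : Generator → SetSystem n → Fin n → SetSystem n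
apply ⋆ = twist
apply ⊹ = loopComplement

-- D g i: the last letter of g acts first.
applyWord : 𝒢 → SetSystem n → Fin n → SetSystem n
applyWord g D i = foldr (λ a E → apply a E i) D g

-- ĝ · D. Operations on distinct elements commute, so the order in which the
-- elements of [n] are processed does not matter.
infixr 7 _·_
_·_ : (Fin n → 𝒢) → SetSystem n → SetSystem n
_·_ {n} ĝ D = foldr (λ i E → applyWord (ĝ i) E i) D (allFin n)

∗̄ : 𝒢
∗̄ = ⊹ ∷ ⋆ ∷ ⊹ ∷ []

infixl 7 _∗̄ˢ_
_∗̄ˢ_ : SetSystem n → Subset n → SetSystem n
D ∗̄ˢ I = (λ i → if lookup I i then ∗̄ else []) · D

VfSafe : SetSystem n → Set
VfSafe D = ∀ ĝ → IsDeltaMatroid (ĝ · D)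

-- D_π
relabel : Permutation′ n → SetSystem n → SetSystem n
relabel π D = image ((π ⟨$⟩ʳ_) ⟦_⟧) D

-- The underlying set of the semidirect product of 𝒢ⁿ and Sₙ, and its action.
𝒢⋊S : ℕ → Set
𝒢⋊S n = (Fin n → 𝒢) × Permutation′ n

infixr 7 _•_
_•_ : 𝒢⋊S n → SetSystem n → SetSystem n
(ĝ , π) • D = ĝ · relabel π D

Orb : SetSystem n → Pred (SetSystem n) 0ℓ
Orb D D′ = ∃ λ γ → D′ ≗ γ • D

-- An (n,3)-carrier. The finite set U is Fin ∣U∣. The skew classes are listed as
-- Ω k for k : Fin n in an arbitrary order, which is unrelated to any projection.
record Carrier (n : ℕ) : Set where
  field
    ∣U∣       : ℕ
    Ω         : Fin n → Subset ∣U∣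
    size      : ∀ k → ∣ Ω k ∣ ≡ 3
    partition : ∀ x → ∃! _≡_ λ k → x ∈ Ω k

module _ (C : Carrier n) where
  open Carrier C

  IsTransversal : Pred (Subset ∣U∣) 0ℓ
  IsTransversal S = ∀ k → ∣ S ∩ Ω k ∣ ≡ 1

  SameSkewClass : Fin ∣U∣ → Fin ∣U∣ → Set
  SameSkewClass x y = ∃ λ k → x ∈ Ω k × y ∈ Ω k

  record TransversalTriple : Set where
    field
      T₁ T₂ T₃       : Subset ∣U∣
      transversal₁   : IsTransversal T₁
      transversal₂   : IsTransversal T₂
      transversal₃   : IsTransversal T₃
      disjoint₁₂     : Empty (T₁ ∩ T₂)
      disjoint₁₃     : Empty (T₁ ∩ T₃)
      disjoint₂₃     : Empty (T₂ ∩ T₃)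
      union          : T₁ ∪ T₂ ∪ T₃ ≡ ⊤

  record Projection : Set where
    field
      σ          : Fin ∣U∣ → Fin n
      surjective : Surjective _≡_ _≡_ σ
      fibres     : ∀ x y → σ x ≡ σ y ⇔ SameSkewClass x y

  ℬ : SetSystem n → TransversalTriple → Projection → Pred (Subset ∣U∣) 0ℓ
  ℬ D τ p B = IsTransversal B × Feasible (D ∗̄ˢ (σ ⟦ B ∩ T₃ ⟧)) (σ ⟦ B ∩ T₂ ⟧)
    where
    open TransversalTriple τ
    open Projection p

  -- The lift (U , Ω , ℬ*), given by its family ℬ* of independent sets. Lifts are only
  -- compared over one carrier (U , Ω), so two of them are equal precisely when
  -- these families have the same members.
  Z : SetSystem n → TransversalTriple → Projection → Pred (Subset ∣U∣) 0ℓ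
  Z D τ p I = ∃ λ B → ℬ D τ p B × I ⊆ B

{-# OPTIONS --safe #-}

-- A set system is a function {0,1}ⁿ → 𝔽₂, and it extends uniquely to a function on {0,1,2}ⁿ whose values at 0, 1
-- and 2 in each coordinate sum to zero (the value at 2 records D ∗̄ i). On extensions, ∗ and + act on a coordinate by
-- the transpositions (0 1) and (1 2), which generate all permutations of {0,1,2}, and Sₙ permutes the coordinates.
-- A triple τ and a projection σ identify U with [n] × {0,1,2}, hence transversals with {0,1,2}ⁿ, and under this
-- identification the bases of Z_{D,τ,σ} are the support of the extension of D. Any two identifications obtained
-- this way differ by an element of 𝒢ⁿ ⋊ Sₙ, and every element arises, so equality of lifts is equality of orbits.
module Submission where

open import Defs
open import Data.Bool using (Bool; true; false; not; _xor_; _∧_; _∨_; T; T?; if_then_else_)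
open import Data.Bool.Properties using (xor-identityʳ; xor-assoc; xor-comm; xor-same; ∨-identityʳ; T-≡)
open import Data.Fin using (Fin; zero; suc; _≟_)
open import Data.Fin.Patterns using (0F; 1F; 2F)
open import Data.Fin.Permutation using (Permutation′; _⟨$⟩ʳ_; _⟨$⟩ˡ_; inverseˡ; inverseʳ; permutation)
open import Data.Fin.Properties using (any?; all?)
open import Data.Fin.Subset using (Subset; _∈_; _∉_; _⊆_; _∩_; _∪_; ⁅_⁆; ⊥; ∣_∣; Empty)
open import Data.Fin.Subset.Properties
  using (_∈?_; anySubset?; ⊆-antisym; ∪-identityʳ; x∈⁅x⁆; x∈⁅y⁆⇒x≡y; ∣⁅x⁆∣≡1; x∈p∩q⁺; x∈p∩q⁻; x∈p∪q⁺; x∈p∪q⁻; ∈⊤; ⊆⊤)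
open import Data.List using (List; []; _∷_; _++_; foldr; foldl; allFin)
open import Data.List.Properties using (foldl-++)
open import Data.List.Membership.Propositional.Properties using (∈-allFin)
import Data.List.Relation.Unary.All as All
open import Data.List.Relation.Unary.Any as Any using (here; there)
open import Data.List.Relation.Unary.AllPairs using ([]; _∷_)
open import Data.List.Relation.Unary.Unique.Propositional using (Unique)
open import Data.List.Relation.Unary.Unique.Propositional.Properties using (allFin⁺)
import Data.List.Membership.Propositional as List
open import Data.Nat using (ℕ; zero; suc)
open import Data.Nat.Properties using (suc-injective)
open import Data.Product using (∃-syntax; _×_; _,_; proj₁; proj₂; Σ-syntax)
open import Data.Sum using (inj₁; inj₂)
open import Data.Vec using (Vec; []; _∷_; tabulate; lookup; updateAt; _[_]≔_; map)
open import Data.Vec.Properties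
  using (tabulate∘lookup; lookup∘tabulate; tabulate-cong; lookup-map; lookup-zipWith; lookup⇒[]=; []=⇒lookup;
         lookup∘updateAt; lookup∘updateAt′; lookup∘update; lookup∘update′; []≔-idempotent; []≔-lookup)
open import Function using (_∘_; _⇔_; mk⇔; Equivalence; Injective)
open import Relation.Binary.PropositionalEquality
  using (_≡_; _≢_; _≗_; refl; sym; trans; cong; cong₂; subst; module ≡-Reasoning)
open import Relation.Nullary using (does; yes; no; ¬?; contradiction)
open import Relation.Nullary.Decidable using (_×-dec_; _⊎-dec_; from-yes; does-⇔; dec-true; dec-false)
open import Relation.Unary using (Decidable; _≐_)

open ≡-Reasoning

private
  variable
    m n : ℕ
    A : Set

-- Subsets as Boolean vectors: membership, preimages and single-element updates.

lookup-ext : {xs ys : Vec A n} → lookup xs ≗ lookup ys → xs ≡ ys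
lookup-ext {xs = xs} {ys} eq = begin
  xs                    ≡⟨ tabulate∘lookup xs ⟨
  tabulate (lookup xs)  ≡⟨ tabulate-cong eq ⟩
  tabulate (lookup ys)  ≡⟨ tabulate∘lookup ys ⟩
  ys                    ∎

∈-tabulate⇔ : {P : Fin n → Set} (P? : Decidable P) {i : Fin n} → i ∈ tabulate (does ∘ P?) ⇔ P i
∈-tabulate⇔ {P = P} P? {i} = mk⇔ to from
  where
  to : i ∈ tabulate (does ∘ P?) → P i
  to i∈ with P? i | trans (sym (lookup∘tabulate (does ∘ P?) i)) ([]=⇒lookup i∈)
  ... | yes Pi | _ = Pi
  from : P i → i ∈ tabulate (does ∘ P?)
  from Pi = lookup⇒[]= i _ (trans (lookup∘tabulate (does ∘ P?) i) (dec-true (P? i) Pi))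

-- On subsets this is the preimage under `f`.
reindex : (Fin m → Fin n) → Vec A n → Vec A m
reindex f xs = tabulate (lookup xs ∘ f)

∈-reindex⇔ : (f : Fin m → Fin n) {S : Subset n} {i : Fin m} → i ∈ reindex f S ⇔ f i ∈ S
∈-reindex⇔ f {S} {i} = mk⇔
  (λ i∈ → lookup⇒[]= (f i) S (trans (sym (lookup∘tabulate _ i)) ([]=⇒lookup i∈)))
  (λ fi∈ → lookup⇒[]= i _ (trans (lookup∘tabulate _ i) ([]=⇒lookup fi∈)))

∈-image⇔ : (f : Fin m → Fin n) {S : Subset m} {j : Fin n} → j ∈ f ⟦ S ⟧ ⇔ (∃[ x ] (x ∈ S × f x ≡ j))
∈-image⇔ f {S} = ∈-tabulate⇔ (λ j → any? λ x → (x ∈? S) ×-dec (f x ≟ j))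

△-⊥ : (X : Subset n) → X △ ⊥ ≡ X
△-⊥ []      = refl
△-⊥ (x ∷ X) = cong₂ _∷_ (xor-identityʳ x) (△-⊥ X)

△-⁅⁆ : (X : Subset n) (i : Fin n) → X △ ⁅ i ⁆ ≡ updateAt X i not
△-⁅⁆ (false ∷ X) zero    = cong (true ∷_) (△-⊥ X)
△-⁅⁆ (true  ∷ X) zero    = cong (false ∷_) (△-⊥ X)
△-⁅⁆ (x ∷ X)     (suc i) = cong₂ _∷_ (xor-identityʳ x) (△-⁅⁆ X i)

∪-⁅⁆ : (X : Subset n) (i : Fin n) → X ∪ ⁅ i ⁆ ≡ X [ i ]≔ true
∪-⁅⁆ (false ∷ X) zero    = cong (true ∷_) (∪-identityʳ X)
∪-⁅⁆ (true  ∷ X) zero    = cong (true ∷_) (∪-identityʳ X)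
∪-⁅⁆ (x ∷ X)     (suc i) = cong₂ _∷_ (∨-identityʳ x) (∪-⁅⁆ X i)

-- Pointwise formulas for twist and loop complementation.

-- The only possible preimage of `Y` is `h Y`, so the search over all subsets collapses to one
-- evaluation. This turns `twist` and `relabel` into precompositions.
image-inverse : {f : Subset m → Subset n} {h : Subset n → Subset m} →
  (∀ X → h (f X) ≡ X) → (∀ Y → f (h Y) ≡ Y) → (D : SetSystem m) → image f D ≗ D ∘ h
image-inverse {f = f} {h} hf fh D Y =
  does-⇔ (mk⇔ to (λ DhY → h Y , DhY , fh Y)) (anySubset? λ X → T? (D X) ×-dec (f X ≟ˢ Y)) (T? (D (h Y)))
  where
  to : (∃[ X ] (Feasible D X × f X ≡ Y)) → Feasible D (h Y)
  to (X , DX , refl) = subst (T ∘ D) (sym (hf X)) DX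

twist-updateAt : (D : SetSystem n) (i : Fin n) (X : Subset n) → twist D i X ≡ D (updateAt X i not)
twist-updateAt D i X = trans (image-inverse involutive involutive D X) (cong D (△-⁅⁆ X i))
  where
  △-△ : ∀ {n} (X Y : Subset n) → X △ Y △ Y ≡ X
  △-△ []      []      = refl
  △-△ (x ∷ X) (y ∷ Y) =
    cong₂ _∷_ (trans (xor-assoc x y y) (trans (cong (x xor_) (xor-same y)) (xor-identityʳ x))) (△-△ X Y)
  involutive : ∀ X → X △ ⁅ i ⁆ △ ⁅ i ⁆ ≡ X
  involutive X = △-△ X ⁅ i ⁆

-- A set `I` avoiding `i` with `I ∪ ⁅ i ⁆ ≡ X` exists only if `i` lies in `X`, and then it is `X`
-- with `i` removed.
loopComplement-remove : (D : SetSystem n) (i : Fin n) (X : Subset n) →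
  loopComplement D i X ≡ D X xor (lookup X i ∧ D (X [ i ]≔ false))
loopComplement-remove D i X = cong (D X xor_)
  (does-⇔ (mk⇔ to from) (anySubset? λ I → T? _ ×-dec ((I ∪ ⁅ i ⁆) ≟ˢ X)) (T? (lookup X i ∧ D (X [ i ]≔ false))))
  where
  Q = λ I → does (T? (D I) ×-dec ¬? (i ∈? I))
  to : (∃[ I ] (T (Q I) × I ∪ ⁅ i ⁆ ≡ X)) → T (lookup X i ∧ D (X [ i ]≔ false))
  to (I , QI , refl) with D I in DI | i ∈? I
  ... | true | no i∉I = Equivalence.from T-≡ (cong₂ _∧_ i∈X (trans (cong D X∖i≡I) DI))
    where
    i∈X : lookup (I ∪ ⁅ i ⁆) i ≡ true
    i∈X = trans (cong (λ Y → lookup Y i) (∪-⁅⁆ I i)) (lookup∘update i I true)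
    lookup-∉ : lookup I i ≡ false
    lookup-∉ with lookup I i in eq
    ... | false = refl
    ... | true  = contradiction (lookup⇒[]= i I eq) i∉I
    X∖i≡I : (I ∪ ⁅ i ⁆) [ i ]≔ false ≡ I
    X∖i≡I = begin
      (I ∪ ⁅ i ⁆) [ i ]≔ false          ≡⟨ cong (_[ i ]≔ false) (∪-⁅⁆ I i) ⟩
      (I [ i ]≔ true) [ i ]≔ false      ≡⟨ []≔-idempotent I i ⟩
      I [ i ]≔ false                    ≡⟨ cong (I [ i ]≔_) lookup-∉ ⟨
      I [ i ]≔ lookup I i               ≡⟨ []≔-lookup I i ⟩
      I                                 ∎
  from : T (lookup X i ∧ D (X [ i ]≔ false)) → ∃[ I ] (T (Q I) × I ∪ ⁅ i ⁆ ≡ X)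
  from t with lookup X i in i∈X | D (X [ i ]≔ false) in DI
  ... | true | true = X [ i ]≔ false , QI , (begin
      (X [ i ]≔ false) ∪ ⁅ i ⁆          ≡⟨ ∪-⁅⁆ _ i ⟩
      (X [ i ]≔ false) [ i ]≔ true      ≡⟨ []≔-idempotent X i ⟩
      X [ i ]≔ true                     ≡⟨ cong (X [ i ]≔_) i∈X ⟨
      X [ i ]≔ lookup X i               ≡⟨ []≔-lookup X i ⟩
      X                                 ∎)
    where
    i∉I : i ∉ X [ i ]≔ false
    i∉I i∈I with () ← trans (sym (lookup∘update i X false)) ([]=⇒lookup i∈I)
    QI : T (Q (X [ i ]≔ false))
    QI = Equivalence.from T-≡ (cong₂ _∧_ DI (cong not (dec-false (i ∈? _) i∉I)))

-- The extension of a set system and multilinearity.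

-- Values 0F, 1F, 2F of a coordinate i select the sets avoiding i, the sets containing i, and the sum mod 2 of the two.
extend : SetSystem n → Vec (Fin 3) n → Bool
extend D []       = D []
extend D (0F ∷ t) = extend (D ∘ (false ∷_)) t
extend D (1F ∷ t) = extend (D ∘ (true ∷_)) t
extend D (2F ∷ t) = extend (D ∘ (false ∷_)) t xor extend (D ∘ (true ∷_)) t

value : Bool → Fin 3
value false = 0F
value true  = 1F

extend-value : (D : SetSystem n) (X : Subset n) → extend D (map value X) ≡ D X
extend-value D []          = refl
extend-value D (false ∷ X) = extend-value (D ∘ (false ∷_)) X
extend-value D (true  ∷ X) = extend-value (D ∘ (true ∷_)) X

extend-cong : {D E : SetSystem n} → D ≗ E → extend D ≗ extend E
extend-cong D≗E []       = D≗E []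
extend-cong D≗E (0F ∷ t) = extend-cong (D≗E ∘ (false ∷_)) t
extend-cong D≗E (1F ∷ t) = extend-cong (D≗E ∘ (true ∷_)) t
extend-cong D≗E (2F ∷ t) = cong₂ _xor_ (extend-cong (D≗E ∘ (false ∷_)) t) (extend-cong (D≗E ∘ (true ∷_)) t)

-- The vectors without `2F` already recover `D`. Identities between set systems can therefore be
-- checked on extensions, where all operations become precompositions.
extend-injective : {D E : SetSystem n} → extend D ≗ extend E → D ≗ E
extend-injective {D = D} {E} eq X = trans (sym (extend-value D X)) (trans (eq (map value X)) (extend-value E X))

xor-interchange : ∀ a b c d → (a xor b) xor (c xor d) ≡ (a xor c) xor (b xor d)
xor-interchange a b c d = begin
  (a xor b) xor (c xor d)  ≡⟨ xor-assoc a b (c xor d) ⟩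
  a xor (b xor (c xor d))  ≡⟨ cong (a xor_) (xor-assoc b c d) ⟨
  a xor ((b xor c) xor d)  ≡⟨ cong (λ e → a xor (e xor d)) (xor-comm b c) ⟩
  a xor ((c xor b) xor d)  ≡⟨ cong (a xor_) (xor-assoc c b d) ⟩
  a xor (c xor (b xor d))  ≡⟨ xor-assoc a c (b xor d) ⟨
  (a xor c) xor (b xor d)  ∎

xor-cancelˡ : ∀ a b → a xor (a xor b) ≡ b
xor-cancelˡ a b = trans (sym (xor-assoc a a b)) (cong (_xor b) (xor-same a))

-- Needed for `⊹`, which replaces the slice of sets containing `i` by a sum of two slices.
extend-xor : (D E : SetSystem n) (t : Vec (Fin 3) n) →
  extend (λ X → D X xor E X) t ≡ extend D t xor extend E t
extend-xor D E []       = refl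
extend-xor D E (0F ∷ t) = extend-xor (D ∘ (false ∷_)) (E ∘ (false ∷_)) t
extend-xor D E (1F ∷ t) = extend-xor (D ∘ (true ∷_)) (E ∘ (true ∷_)) t
extend-xor D E (2F ∷ t) = trans
  (cong₂ _xor_ (extend-xor (D ∘ (false ∷_)) (E ∘ (false ∷_)) t) (extend-xor (D ∘ (true ∷_)) (E ∘ (true ∷_)) t))
  (xor-interchange (extend (D ∘ (false ∷_)) t) _ _ _)

-- Reading `0F`, `1F`, `2F` as the nonzero vectors e, f, e + f of the plane over the two-element
-- field, this is additivity in each coordinate.
Multilinear : (Vec (Fin 3) n → Bool) → Set
Multilinear G = ∀ t i → G (t [ i ]≔ 2F) ≡ G (t [ i ]≔ 0F) xor G (t [ i ]≔ 1F)

extend-multilinear : (D : SetSystem n) → Multilinear (extend D)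
extend-multilinear D (s  ∷ t) zero    = refl
extend-multilinear D (0F ∷ t) (suc i) = extend-multilinear (D ∘ (false ∷_)) t i
extend-multilinear D (1F ∷ t) (suc i) = extend-multilinear (D ∘ (true ∷_)) t i
extend-multilinear D (2F ∷ t) (suc i) = trans
  (cong₂ _xor_ (extend-multilinear (D ∘ (false ∷_)) t i) (extend-multilinear (D ∘ (true ∷_)) t i))
  (xor-interchange (extend (D ∘ (false ∷_)) (t [ i ]≔ 0F)) _ _ _)

-- Each `2F` can be traded for `0F` and `1F`, so the values on subsets determine `G`. This handles
-- relabelling, which does not follow the coordinate order in which `extend` recurses.
multilinear-unique : {G : Vec (Fin 3) n → Bool} → Multilinear G → G ≗ extend (G ∘ map value)
multilinear-unique lin []       = refl
multilinear-unique lin (0F ∷ t) = multilinear-unique (λ s i → lin (0F ∷ s) (suc i)) t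
multilinear-unique lin (1F ∷ t) = multilinear-unique (λ s i → lin (1F ∷ s) (suc i)) t
multilinear-unique {G = G} lin (2F ∷ t) = trans (lin (2F ∷ t) zero) (cong₂ _xor_
  (multilinear-unique {G = G ∘ (0F ∷_)} (λ s i → lin (0F ∷ s) (suc i)) t)
  (multilinear-unique {G = G ∘ (1F ∷_)} (λ s i → lin (1F ∷ s) (suc i)) t))

-- Words acting on coordinates of the extension.

transpose : Generator → Fin 3 → Fin 3
transpose ⋆ 0F = 1F
transpose ⋆ 1F = 0F
transpose ⋆ 2F = 2F
transpose ⊹ 0F = 0F
transpose ⊹ 1F = 2F
transpose ⊹ 2F = 1F

-- A left fold, because precomposition reverses order: the last letter acts first on the set system,
-- but the first letter acts first on the coordinate value.
permute : 𝒢 → Fin 3 → Fin 3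
permute g s = foldl (λ s a → transpose a s) s g

apply-cong : (a : Generator) (i : Fin n) {D E : SetSystem n} → D ≗ E → apply a D i ≗ apply a E i
apply-cong ⋆ i {D} {E} D≗E X =
  trans (twist-updateAt D i X) (trans (D≗E _) (sym (twist-updateAt E i X)))
apply-cong ⊹ i {D} {E} D≗E X = trans (loopComplement-remove D i X)
  (trans (cong₂ (λ b c → b xor (lookup X i ∧ c)) (D≗E _) (D≗E _)) (sym (loopComplement-remove E i X)))

-- An operation at a later element leaves the first coordinate alone, so it restricts to the two
-- slices; this drives the induction in `extend-apply`.
apply-∷ : (a : Generator) (D : SetSystem (suc n)) (i : Fin n) (x : Bool) →
  apply a D (suc i) ∘ (x ∷_) ≗ apply a (D ∘ (x ∷_)) i
apply-∷ ⋆ D i x X = trans (twist-updateAt D (suc i) (x ∷ X)) (sym (twist-updateAt (D ∘ (x ∷_)) i X))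
apply-∷ ⊹ D i x X = trans (loopComplement-remove D (suc i) (x ∷ X)) (sym (loopComplement-remove (D ∘ (x ∷_)) i X))

-- At the first coordinate, `⋆` exchanges the two slices and preserves their sum. The operation `⊹`
-- keeps the slice at `false` and exchanges the slice at `true` with the sum, since adding the first
-- slice twice cancels.
extend-apply : (a : Generator) (D : SetSystem n) (i : Fin n) (t : Vec (Fin 3) n) →
  extend (apply a D i) t ≡ extend D (updateAt t i (transpose a))
extend-apply ⋆ D zero (0F ∷ t) = extend-cong (λ X → twist-updateAt D zero (false ∷ X)) t
extend-apply ⋆ D zero (1F ∷ t) = extend-cong (λ X → twist-updateAt D zero (true ∷ X)) t
extend-apply ⋆ D zero (2F ∷ t) = trans
  (cong₂ _xor_ (extend-apply ⋆ D zero (0F ∷ t)) (extend-apply ⋆ D zero (1F ∷ t)))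
  (xor-comm (extend (D ∘ (true ∷_)) t) _)
extend-apply ⊹ D zero (0F ∷ t) =
  extend-cong (λ X → trans (loopComplement-remove D zero (false ∷ X)) (xor-identityʳ _)) t
extend-apply ⊹ D zero (1F ∷ t) = trans
  (extend-cong (λ X → trans (loopComplement-remove D zero (true ∷ X)) (xor-comm (D (true ∷ X)) _)) t)
  (extend-xor (D ∘ (false ∷_)) (D ∘ (true ∷_)) t)
extend-apply ⊹ D zero (2F ∷ t) = trans
  (cong₂ _xor_ (extend-apply ⊹ D zero (0F ∷ t)) (extend-apply ⊹ D zero (1F ∷ t)))
  (xor-cancelˡ (extend (D ∘ (false ∷_)) t) _)
extend-apply a D (suc i) (0F ∷ t) = trans (extend-cong (apply-∷ a D i false) t) (extend-apply a _ i t)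
extend-apply a D (suc i) (1F ∷ t) = trans (extend-cong (apply-∷ a D i true) t) (extend-apply a _ i t)
extend-apply a D (suc i) (2F ∷ t) = cong₂ _xor_
  (trans (extend-cong (apply-∷ a D i false) t) (extend-apply a _ i t))
  (trans (extend-cong (apply-∷ a D i true) t) (extend-apply a _ i t))

updateAt-∘ : (t : Vec A n) (i : Fin n) {f g : A → A} → updateAt (updateAt t i f) i g ≡ updateAt t i (g ∘ f)
updateAt-∘ (s ∷ t) zero    = refl
updateAt-∘ (s ∷ t) (suc i) = cong (s ∷_) (updateAt-∘ t i)

updateAt-id : (t : Vec A n) (i : Fin n) → updateAt t i (λ s → s) ≡ t
updateAt-id (s ∷ t) zero    = refl
updateAt-id (s ∷ t) (suc i) = cong (s ∷_) (updateAt-id t i)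

extend-applyWord : (g : 𝒢) (D : SetSystem n) (i : Fin n) (t : Vec (Fin 3) n) →
  extend (applyWord g D i) t ≡ extend D (updateAt t i (permute g))
extend-applyWord []      D i t = cong (extend D) (sym (updateAt-id t i))
extend-applyWord (a ∷ g) D i t = begin
  extend (apply a (applyWord g D i) i) t                         ≡⟨ extend-apply a _ i t ⟩
  extend (applyWord g D i) (updateAt t i (transpose a))          ≡⟨ extend-applyWord g D i (updateAt t i (transpose a)) ⟩
  extend D (updateAt (updateAt t i (transpose a)) i (permute g)) ≡⟨ cong (extend D) (updateAt-∘ t i) ⟩
  extend D (updateAt t i (permute (a ∷ g)))                      ∎

permuteAll : (Fin n → 𝒢) → Vec (Fin 3) n → Vec (Fin 3) n
permuteAll ĝ t = tabulate λ i → permute (ĝ i) (lookup t i)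

-- The operations performed one after another on `D` become successive updates of `t`. Since
-- `allFin n` lists every index exactly once, coordinate `j` is changed only by `ĝ j`, and only
-- once.
extend-· : (ĝ : Fin n → 𝒢) (D : SetSystem n) (t : Vec (Fin 3) n) →
  extend (ĝ · D) t ≡ extend D (permuteAll ĝ t)
extend-· {n} ĝ D t = trans (extend-foldr (allFin n) t) (cong (extend D) foldl-allFin)
  where
  step : Vec (Fin 3) n → Fin n → Vec (Fin 3) n
  step t i = updateAt t i (permute (ĝ i))
  extend-foldr : ∀ l t → extend (foldr (λ i E → applyWord (ĝ i) E i) D l) t ≡ extend D (foldl step t l)
  extend-foldr []      t = refl
  extend-foldr (i ∷ l) t = trans (extend-applyWord (ĝ i) _ i t) (extend-foldr l _)
  lookup-foldl-∉ : ∀ {l j} → All.All (j ≢_) l → ∀ t → lookup (foldl step t l) j ≡ lookup t j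
  lookup-foldl-∉ All.[]           t = refl
  lookup-foldl-∉ (j≢i All.∷ j∉l) t = trans (lookup-foldl-∉ j∉l _) (lookup∘updateAt′ _ _ j≢i t)
  lookup-foldl-∈ : ∀ {l j} → Unique l → j List.∈ l → ∀ t → lookup (foldl step t l) j ≡ permute (ĝ j) (lookup t j)
  lookup-foldl-∈ (i∉l ∷ _) (here refl) t = trans (lookup-foldl-∉ i∉l _) (lookup∘updateAt _ t)
  lookup-foldl-∈ (i∉l ∷ u) (there j∈l) t = trans (lookup-foldl-∈ u j∈l _)
    (cong (permute (ĝ _)) (lookup∘updateAt′ _ _ (All.lookup i∉l j∈l ∘ sym) t))
  foldl-allFin : foldl step t (allFin n) ≡ permuteAll ĝ t
  foldl-allFin = lookup-ext λ j →
    trans (lookup-foldl-∈ (allFin⁺ n) (∈-allFin j) t) (sym (lookup∘tabulate (λ i → permute (ĝ i) (lookup t i)) j))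

-- For the transversal encoded by `t`, this is the image under `σ` of its intersection with the part
-- of the triple numbered `j`; see `σ-basis∩part`.
level : Fin 3 → Vec (Fin 3) n → Subset n
level j t = tabulate λ i → does (lookup t i ≟ j)

-- The word `∗̄` acts on values as the transposition of `0F` and `2F`. The characteristic vector of
-- `level 1F t` has `0F` wherever `t` has `2F`, so applying `∗̄` exactly there restores `t`.
∗̄ˢ-extend : (D : SetSystem n) (t : Vec (Fin 3) n) → (D ∗̄ˢ level 2F t) (level 1F t) ≡ extend D t
∗̄ˢ-extend D t = begin
  (D ∗̄ˢ level 2F t) (level 1F t)                     ≡⟨ extend-value (D ∗̄ˢ level 2F t) (level 1F t) ⟨
  extend (D ∗̄ˢ level 2F t) (map value (level 1F t))  ≡⟨ extend-· ĝ D (map value (level 1F t)) ⟩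
  extend D (permuteAll ĝ (map value (level 1F t)))   ≡⟨ cong (extend D) permuted ⟩
  extend D t                                         ∎
  where
  ĝ : Fin _ → 𝒢
  ĝ i = if lookup (level 2F t) i then ∗̄ else []
  by-value : ∀ s → permute (if does (s ≟ 2F) then ∗̄ else []) (value (does (s ≟ 1F))) ≡ s
  by-value 0F = refl
  by-value 1F = refl
  by-value 2F = refl
  permuted : permuteAll ĝ (map value (level 1F t)) ≡ t
  permuted = lookup-ext λ i → begin
    lookup (permuteAll ĝ (map value (level 1F t))) i   ≡⟨ lookup∘tabulate _ i ⟩
    permute (ĝ i) (lookup (map value (level 1F t)) i)  ≡⟨ cong (permute (ĝ i)) (lookup-map i value (level 1F t)) ⟩
    permute (ĝ i) (value (lookup (level 1F t) i))
      ≡⟨ cong₂ (λ b c → permute (if b then ∗̄ else []) (value c)) (lookup∘tabulate _ i) (lookup∘tabulate _ i) ⟩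
    permute (if does (lookup t i ≟ 2F) then ∗̄ else []) (value (does (lookup t i ≟ 1F)))
      ≡⟨ by-value (lookup t i) ⟩
    lookup t i ∎

-- Relabelling and the action of the semidirect product on extensions.

relabel-reindex : (π : Permutation′ n) (D : SetSystem n) → relabel π D ≗ D ∘ reindex (π ⟨$⟩ʳ_)
relabel-reindex π = image-inverse
  (λ X → ⊆-antisym
    (λ i∈ → let x , x∈X , πx≡πi = image⇒ (reindex⇒ i∈)
            in subst (_∈ X) (trans (sym (inverseˡ π)) (trans (cong (π ⟨$⟩ˡ_) πx≡πi) (inverseˡ π))) x∈X)
    (λ i∈ → reindex⇐ (image⇐ (_ , i∈ , refl))))
  (λ Y → ⊆-antisym
    (λ i∈ → let x , x∈ , πx≡i = image⇒ i∈ in subst (_∈ Y) πx≡i (reindex⇒ x∈))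
    (λ {i} i∈ → image⇐ (π ⟨$⟩ˡ i , reindex⇐ (subst (_∈ Y) (sym (inverseʳ π)) i∈) , inverseʳ π)))
  where
  open module Image {S j} = Equivalence (∈-image⇔ (π ⟨$⟩ʳ_) {S} {j}) using () renaming (to to image⇒; from to image⇐)
  open module Reindex {S i} = Equivalence (∈-reindex⇔ (π ⟨$⟩ʳ_) {S} {i}) using () renaming (to to reindex⇒; from to reindex⇐)

reindex-[]≔ : (π : Permutation′ n) (t : Vec A n) (i : Fin n) (s : A) →
  reindex (π ⟨$⟩ʳ_) (t [ i ]≔ s) ≡ reindex (π ⟨$⟩ʳ_) t [ π ⟨$⟩ˡ i ]≔ s
reindex-[]≔ π t i s = lookup-ext λ j → trans (lookup∘tabulate _ j) (by-index j)
  where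
  by-index : ∀ j → lookup (t [ i ]≔ s) (π ⟨$⟩ʳ j) ≡ lookup (reindex (π ⟨$⟩ʳ_) t [ π ⟨$⟩ˡ i ]≔ s) j
  by-index j with j ≟ π ⟨$⟩ˡ i
  ... | yes refl = begin
    lookup (t [ i ]≔ s) (π ⟨$⟩ʳ (π ⟨$⟩ˡ i))  ≡⟨ cong (lookup (t [ i ]≔ s)) (inverseʳ π) ⟩
    lookup (t [ i ]≔ s) i                    ≡⟨ lookup∘update i t s ⟩
    s                                        ≡⟨ lookup∘update j (reindex (π ⟨$⟩ʳ_) t) s ⟨
    lookup (reindex (π ⟨$⟩ʳ_) t [ j ]≔ s) j  ∎
  ... | no j≢ = begin
    lookup (t [ i ]≔ s) (π ⟨$⟩ʳ j)    ≡⟨ lookup∘update′ (λ { refl → j≢ (sym (inverseˡ π)) }) t s ⟩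
    lookup t (π ⟨$⟩ʳ j)               ≡⟨ lookup∘tabulate _ j ⟨
    lookup (reindex (π ⟨$⟩ʳ_) t) j    ≡⟨ lookup∘update′ j≢ (reindex (π ⟨$⟩ʳ_) t) s ⟨
    lookup (reindex (π ⟨$⟩ʳ_) t [ π ⟨$⟩ˡ i ]≔ s) j ∎

map-reindex : {B : Set} (f : A → B) (h : Fin m → Fin n) (xs : Vec A n) → reindex h (map f xs) ≡ map f (reindex h xs)
map-reindex f h xs = lookup-ext λ i → begin
  lookup (reindex h (map f xs)) i  ≡⟨ lookup∘tabulate _ i ⟩
  lookup (map f xs) (h i)          ≡⟨ lookup-map (h i) f xs ⟩
  f (lookup xs (h i))              ≡⟨ cong f (lookup∘tabulate _ i) ⟨
  f (lookup (reindex h xs) i)      ≡⟨ lookup-map i f (reindex h xs) ⟨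
  lookup (map f (reindex h xs)) i  ∎

-- Reindexing respects multilinearity, so it suffices to compare both sides on subsets.
extend-relabel : (π : Permutation′ n) (D : SetSystem n) → extend (relabel π D) ≗ extend D ∘ reindex (π ⟨$⟩ʳ_)
extend-relabel π D t = sym (trans (multilinear-unique linear t) (extend-cong agree t))
  where
  ρ : {B : Set} → Vec B _ → Vec B _
  ρ = reindex (π ⟨$⟩ʳ_)
  linear : Multilinear (extend D ∘ ρ)
  linear t i rewrite reindex-[]≔ π t i 0F | reindex-[]≔ π t i 1F | reindex-[]≔ π t i 2F =
    extend-multilinear D (ρ t) (π ⟨$⟩ˡ i)
  agree : ∀ X → extend D (ρ (map value X)) ≡ relabel π D X
  agree X = begin
    extend D (ρ (map value X))  ≡⟨ cong (extend D) (map-reindex value _ X) ⟩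
    extend D (map value (ρ X))  ≡⟨ extend-value D (ρ X) ⟩
    D (ρ X)                     ≡⟨ relabel-reindex π D X ⟨
    relabel π D X               ∎

-- The substitution by which `γ` acts on extensions. The words act on `D` after the relabelling,
-- hence on `t` before it.
pull : 𝒢⋊S n → Vec (Fin 3) n → Vec (Fin 3) n
pull (ĝ , π) = reindex (π ⟨$⟩ʳ_) ∘ permuteAll ĝ

lookup-pull : (γ : 𝒢⋊S n) (t : Vec (Fin 3) n) (i : Fin n) → let ĝ , π = γ in
  lookup (pull γ t) i ≡ permute (ĝ (π ⟨$⟩ʳ i)) (lookup t (π ⟨$⟩ʳ i))
lookup-pull (_ , π) t i = trans (lookup∘tabulate _ i) (lookup∘tabulate _ (π ⟨$⟩ʳ i))

extend-• : (γ : 𝒢⋊S n) (D : SetSystem n) → extend (γ • D) ≗ extend D ∘ pull γ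
extend-• (ĝ , π) D t = trans (extend-· ĝ _ t) (extend-relabel π D (permuteAll ĝ t))

-- Vf-safety is constant on orbits.

IsDeltaMatroid-resp-≗ : {D E : SetSystem n} → D ≗ E → IsDeltaMatroid D → IsDeltaMatroid E
IsDeltaMatroid-resp-≗ {D = D} {E} D≗E Δ = record
  { nonempty = let X , DX = nonempty in X , to DX
  ; exchange = λ X Y EX EY u u∈ → let v , v∈ , Dv = exchange X Y (from EX) (from EY) u u∈ in v , v∈ , to Dv
  }
  where
  open IsDeltaMatroid Δ
  to : ∀ {X} → Feasible D X → Feasible E X
  to {X} = subst T (D≗E X)
  from : ∀ {X} → Feasible E X → Feasible D X
  from {X} = subst T (sym (D≗E X))

reindex-△ : (f : Fin m → Fin n) (X Y : Subset n) → reindex f (X △ Y) ≡ reindex f X △ reindex f Y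
reindex-△ f X Y = lookup-ext λ i → begin
  lookup (reindex f (X △ Y)) i                     ≡⟨ lookup∘tabulate _ i ⟩
  lookup (X △ Y) (f i)                             ≡⟨ lookup-zipWith _xor_ (f i) X Y ⟩
  lookup X (f i) xor lookup Y (f i)                ≡⟨ cong₂ _xor_ (lookup∘tabulate _ i) (lookup∘tabulate _ i) ⟨
  lookup (reindex f X) i xor lookup (reindex f Y) i ≡⟨ lookup-zipWith _xor_ i (reindex f X) _ ⟨
  lookup (reindex f X △ reindex f Y) i             ∎

reindex-∪ : (f : Fin m → Fin n) (X Y : Subset n) → reindex f (X ∪ Y) ≡ reindex f X ∪ reindex f Y
reindex-∪ f X Y = lookup-ext λ i → begin
  lookup (reindex f (X ∪ Y)) i                     ≡⟨ lookup∘tabulate _ i ⟩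
  lookup (X ∪ Y) (f i)                             ≡⟨ lookup-zipWith _∨_ (f i) X Y ⟩
  lookup X (f i) ∨ lookup Y (f i)                  ≡⟨ cong₂ _∨_ (lookup∘tabulate _ i) (lookup∘tabulate _ i) ⟨
  lookup (reindex f X) i ∨ lookup (reindex f Y) i  ≡⟨ lookup-zipWith _∨_ i (reindex f X) _ ⟨
  lookup (reindex f X ∪ reindex f Y) i             ∎

reindex-⁅⁆ : (π : Permutation′ n) (i : Fin n) → reindex (π ⟨$⟩ʳ_) ⁅ π ⟨$⟩ʳ i ⁆ ≡ ⁅ i ⁆
reindex-⁅⁆ π i = ⊆-antisym
  (λ {j} j∈ → subst (_∈ ⁅ i ⁆)
    (trans (sym (inverseˡ π))
      (trans (cong (π ⟨$⟩ˡ_) (sym (x∈⁅y⁆⇒x≡y _ (Equivalence.to (∈-reindex⇔ (π ⟨$⟩ʳ_)) j∈)))) (inverseˡ π)))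
    (x∈⁅x⁆ i))
  (λ {j} j∈ → Equivalence.from (∈-reindex⇔ (π ⟨$⟩ʳ_))
    (subst (λ k → π ⟨$⟩ʳ k ∈ ⁅ π ⟨$⟩ʳ i ⁆) (sym (x∈⁅y⁆⇒x≡y i j∈)) (x∈⁅x⁆ _)))

-- Preimage under `π` preserves symmetric differences, unions and singletons, so an exchange in
-- `relabel π D` at `u` is an exchange in `D` at `π ⟨$⟩ˡ u`, and the partner found there is carried
-- back by `π`.
relabel-isDeltaMatroid : (π : Permutation′ n) {D : SetSystem n} → IsDeltaMatroid D → IsDeltaMatroid (relabel π D)
relabel-isDeltaMatroid π {D} Δ = IsDeltaMatroid-resp-≗ (λ X → sym (relabel-reindex π D X)) (record
  { nonempty = let X , DX = nonempty in reindex (π ⟨$⟩ˡ_) X , subst (T ∘ D) (sym (retract X)) DX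
  ; exchange = λ X Y DX DY u u∈ →
      let v , v∈ , Dv = exchange (ρ X) (ρ Y) DX DY (π ⟨$⟩ˡ u)
            (subst (_ ∈_) (reindex-△ _ X Y)
              (Equivalence.from (∈-reindex⇔ (π ⟨$⟩ʳ_)) (subst (_∈ X △ Y) (sym (inverseʳ π)) u∈)))
      in π ⟨$⟩ʳ v
       , Equivalence.to (∈-reindex⇔ (π ⟨$⟩ʳ_)) (subst (v ∈_) (sym (reindex-△ _ X Y)) v∈)
       , subst (T ∘ D) (sym (exchanged X u v)) Dv
  })
  where
  open IsDeltaMatroid Δ
  ρ : {B : Set} → Vec B _ → Vec B _
  ρ = reindex (π ⟨$⟩ʳ_)
  retract : ∀ X → ρ (reindex (π ⟨$⟩ˡ_) X) ≡ X
  retract X = lookup-ext λ i →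
    trans (lookup∘tabulate _ i) (trans (lookup∘tabulate _ (π ⟨$⟩ʳ i)) (cong (lookup X) (inverseˡ π)))
  exchanged : ∀ X u v → ρ (X △ (⁅ u ⁆ ∪ ⁅ π ⟨$⟩ʳ v ⁆)) ≡ ρ X △ (⁅ π ⟨$⟩ˡ u ⁆ ∪ ⁅ v ⁆)
  exchanged X u v = begin
    ρ (X △ (⁅ u ⁆ ∪ ⁅ π ⟨$⟩ʳ v ⁆))       ≡⟨ reindex-△ _ X _ ⟩
    ρ X △ ρ (⁅ u ⁆ ∪ ⁅ π ⟨$⟩ʳ v ⁆)       ≡⟨ cong (ρ X △_) (reindex-∪ _ ⁅ u ⁆ _) ⟩
    ρ X △ (ρ ⁅ u ⁆ ∪ ρ ⁅ π ⟨$⟩ʳ v ⁆)     ≡⟨ cong (λ w → ρ X △ (ρ ⁅ w ⁆ ∪ ρ ⁅ π ⟨$⟩ʳ v ⁆)) (inverseʳ π) ⟨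
    ρ X △ (ρ ⁅ π ⟨$⟩ʳ (π ⟨$⟩ˡ u) ⁆ ∪ ρ ⁅ π ⟨$⟩ʳ v ⁆)
      ≡⟨ cong₂ (λ S S′ → ρ X △ (S ∪ S′)) (reindex-⁅⁆ π _) (reindex-⁅⁆ π v) ⟩
    ρ X △ (⁅ π ⟨$⟩ˡ u ⁆ ∪ ⁅ v ⁆)         ∎

permute-++ : (g h : 𝒢) (s : Fin 3) → permute (g ++ h) s ≡ permute h (permute g s)
permute-++ g h s = foldl-++ (λ s a → transpose a s) s g h

-- Moving the relabelling outermost reindexes the words by `π`; what remains inside is a tuple of
-- words applied to `D`, to which vf-safety of `D` applies.
·-•-relabel : (ĥ : Fin n → 𝒢) (γ : 𝒢⋊S n) (D : SetSystem n) → let ĝ , π = γ in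
  ĥ · γ • D ≗ relabel π ((λ i → ĥ (π ⟨$⟩ʳ i) ++ ĝ (π ⟨$⟩ʳ i)) · D)
·-•-relabel ĥ γ@(ĝ , π) D = extend-injective λ t → begin
  extend (ĥ · γ • D) t                           ≡⟨ extend-· ĥ (γ • D) t ⟩
  extend (γ • D) (permuteAll ĥ t)                ≡⟨ extend-• γ D (permuteAll ĥ t) ⟩
  extend D (pull γ (permuteAll ĥ t))             ≡⟨ cong (extend D) (pull-permuteAll t) ⟩
  extend D (permuteAll k̂ (reindex (π ⟨$⟩ʳ_) t))  ≡⟨ extend-· k̂ D (reindex (π ⟨$⟩ʳ_) t) ⟨
  extend (k̂ · D) (reindex (π ⟨$⟩ʳ_) t)           ≡⟨ extend-relabel π (k̂ · D) t ⟨
  extend (relabel π (k̂ · D)) t                   ∎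
  where
  k̂ = λ i → ĥ (π ⟨$⟩ʳ i) ++ ĝ (π ⟨$⟩ʳ i)
  pull-permuteAll : ∀ t → pull γ (permuteAll ĥ t) ≡ permuteAll k̂ (reindex (π ⟨$⟩ʳ_) t)
  pull-permuteAll t = lookup-ext λ i → begin
    lookup (pull γ (permuteAll ĥ t)) i
      ≡⟨ lookup-pull γ (permuteAll ĥ t) i ⟩
    permute (ĝ (π ⟨$⟩ʳ i)) (lookup (permuteAll ĥ t) (π ⟨$⟩ʳ i))
      ≡⟨ cong (permute (ĝ (π ⟨$⟩ʳ i))) (lookup∘tabulate _ (π ⟨$⟩ʳ i)) ⟩
    permute (ĝ (π ⟨$⟩ʳ i)) (permute (ĥ (π ⟨$⟩ʳ i)) (lookup t (π ⟨$⟩ʳ i)))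
      ≡⟨ permute-++ (ĥ (π ⟨$⟩ʳ i)) (ĝ (π ⟨$⟩ʳ i)) _ ⟨
    permute (k̂ i) (lookup t (π ⟨$⟩ʳ i))
      ≡⟨ cong (permute (k̂ i)) (lookup∘tabulate _ i) ⟨
    permute (k̂ i) (lookup (reindex (π ⟨$⟩ʳ_) t) i)
      ≡⟨ lookup∘tabulate _ i ⟨
    lookup (permuteAll k̂ (reindex (π ⟨$⟩ʳ_) t)) i ∎

·-cong : (ĝ : Fin n → 𝒢) {D E : SetSystem n} → D ≗ E → ĝ · D ≗ ĝ · E
·-cong ĝ {D} {E} D≗E = extend-injective λ t →
  trans (extend-· ĝ D t) (trans (extend-cong D≗E (permuteAll ĝ t)) (sym (extend-· ĝ E t)))

orbit-vfSafe : {D D′ : SetSystem n} → VfSafe D → Orb D D′ → VfSafe D′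
orbit-vfSafe {D = D} {D′} safe (γ@(ĝ , π) , D′≗γD) ĥ = IsDeltaMatroid-resp-≗
  (λ X → sym (trans (·-cong ĥ {D′} {γ • D} D′≗γD X) (·-•-relabel ĥ γ D X)))
  (relabel-isDeltaMatroid π (safe λ i → ĥ (π ⟨$⟩ʳ i) ++ ĝ (π ⟨$⟩ʳ i)))

-- Carriers and lifts

transpose-involutive : ∀ a s → transpose a (transpose a s) ≡ s
transpose-involutive ⋆ 0F = refl
transpose-involutive ⋆ 1F = refl
transpose-involutive ⋆ 2F = refl
transpose-involutive ⊹ 0F = refl
transpose-involutive ⊹ 1F = refl
transpose-involutive ⊹ 2F = refl

permute-injective : ∀ g → Injective _≡_ _≡_ (permute g)
permute-injective []      eq = eq
permute-injective (a ∷ g) {s} {r} eq = begin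
  s                            ≡⟨ transpose-involutive a s ⟨
  transpose a (transpose a s)  ≡⟨ cong (transpose a) (permute-injective g eq) ⟩
  transpose a (transpose a r)  ≡⟨ transpose-involutive a r ⟩
  r                            ∎

permute-surjective : ∀ g s → ∃[ r ] permute g r ≡ s
permute-surjective []      s = s , refl
permute-surjective (a ∷ g) s = let r , eq = permute-surjective g s in
  transpose a r , trans (cong (permute g) (transpose-involutive a r)) eq

-- The transpositions (0 1) and (1 2) generate the symmetric group on three letters; six words
-- represent its elements.
permute-complete : (f : Fin 3 → Fin 3) → Injective _≡_ _≡_ f → ∃[ g ] permute g ≗ f
permute-complete f f-injective with from-yes search (f 0F) (f 1F) (f 2F)
  where
  words : List 𝒢
  words = [] ∷ (⋆ ∷ []) ∷ (⊹ ∷ []) ∷ (⋆ ∷ ⊹ ∷ []) ∷ (⊹ ∷ ⋆ ∷ []) ∷ (⋆ ∷ ⊹ ∷ ⋆ ∷ []) ∷ []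
  -- By evaluation, every triple of values either has a repetition, which injectivity excludes
  -- below, or is realised by a listed word.
  search = all? λ a → all? λ b → all? λ c →
    ((a ≟ b) ⊎-dec ((a ≟ c) ⊎-dec (b ≟ c))) ⊎-dec
    Any.any? (λ g → (permute g 0F ≟ a) ×-dec ((permute g 1F ≟ b) ×-dec (permute g 2F ≟ c))) words
... | inj₁ (inj₁ eq)        with () ← f-injective eq
... | inj₁ (inj₂ (inj₁ eq)) with () ← f-injective eq
... | inj₁ (inj₂ (inj₂ eq)) with () ← f-injective eq
... | inj₂ found with Any.satisfied found
... | g , eq₀ , eq₁ , eq₂ = g , λ { 0F → eq₀ ; 1F → eq₁ ; 2F → eq₂ }

-- Solved one coordinate at a time; it guarantees in `Z-•` that every transversal is reached by the
-- change of coordinates.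
pull-surjective : (γ : 𝒢⋊S n) (s : Vec (Fin 3) n) → ∃[ t ] pull γ t ≡ s
pull-surjective γ@(ĝ , π) s = t , lookup-ext λ i → begin
  lookup (pull γ t) i                             ≡⟨ lookup-pull γ t i ⟩
  permute (ĝ (π ⟨$⟩ʳ i)) (lookup t (π ⟨$⟩ʳ i))    ≡⟨ cong (permute (ĝ (π ⟨$⟩ʳ i))) (lookup∘tabulate _ (π ⟨$⟩ʳ i)) ⟩
  permute (ĝ (π ⟨$⟩ʳ i)) (proj₁ (preimage (π ⟨$⟩ʳ i))) ≡⟨ proj₂ (preimage (π ⟨$⟩ʳ i)) ⟩
  lookup s (π ⟨$⟩ˡ (π ⟨$⟩ʳ i))                    ≡⟨ cong (lookup s) (inverseˡ π) ⟩
  lookup s i                                      ∎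
  where
  preimage : ∀ j → ∃[ r ] permute (ĝ j) r ≡ lookup s (π ⟨$⟩ˡ j)
  preimage j = permute-surjective (ĝ j) (lookup s (π ⟨$⟩ˡ j))
  t = tabulate (proj₁ ∘ preimage)

∣p∣≡0⇒p≡⊥ : (S : Subset n) → ∣ S ∣ ≡ 0 → S ≡ ⊥
∣p∣≡0⇒p≡⊥ []          _  = refl
∣p∣≡0⇒p≡⊥ (false ∷ S) eq = cong (false ∷_) (∣p∣≡0⇒p≡⊥ S eq)

∣p∣≡1⇒p≡⁅x⁆ : (S : Subset n) → ∣ S ∣ ≡ 1 → ∃[ x ] S ≡ ⁅ x ⁆
∣p∣≡1⇒p≡⁅x⁆ (true  ∷ S) eq = zero , cong (true ∷_) (∣p∣≡0⇒p≡⊥ S (suc-injective eq))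
∣p∣≡1⇒p≡⁅x⁆ (false ∷ S) eq = let x , S≡⁅x⁆ = ∣p∣≡1⇒p≡⁅x⁆ S eq in suc x , cong (false ∷_) S≡⁅x⁆

∣p∩q∣≡1⇒meet : (S R : Subset n) → ∣ S ∩ R ∣ ≡ 1 → ∃[ x ] (x ∈ S × x ∈ R)
∣p∩q∣≡1⇒meet S R eq = let x , S∩R≡⁅x⁆ = ∣p∣≡1⇒p≡⁅x⁆ (S ∩ R) eq in
  x , x∈p∩q⁻ S R (subst (x ∈_) (sym S∩R≡⁅x⁆) (x∈⁅x⁆ x))

∣p∩q∣≡1⇒unique : (S R : Subset n) → ∣ S ∩ R ∣ ≡ 1 →
  ∀ {x y} → x ∈ S → x ∈ R → y ∈ S → y ∈ R → x ≡ y
∣p∩q∣≡1⇒unique S R eq {x} {y} x∈S x∈R y∈S y∈R with ∣p∣≡1⇒p≡⁅x⁆ (S ∩ R) eq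
... | z , S∩R≡⁅z⁆ = trans (collapse x∈S x∈R) (sym (collapse y∈S y∈R))
  where
  collapse : ∀ {w} → w ∈ S → w ∈ R → w ≡ z
  collapse w∈S w∈R = x∈⁅y⁆⇒x≡y z (subst (_ ∈_) S∩R≡⁅z⁆ (x∈p∩q⁺ (w∈S , w∈R)))

-- Coordinates on a carrier given by a triple and a projection.

module Coordinates (C : Carrier n) (τ : TransversalTriple C) (p : Projection C) where
  open Carrier C
  open TransversalTriple τ
  open Projection p

  part : Fin 3 → Subset ∣U∣
  part 0F = T₁
  part 1F = T₂
  part 2F = T₃

  part-transversal : ∀ j → IsTransversal C (part j)
  part-transversal 0F = transversal₁
  part-transversal 1F = transversal₂
  part-transversal 2F = transversal₃

  part-unique : ∀ {x} i j → x ∈ part i → x ∈ part j → i ≡ j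
  part-unique 0F 0F _  _  = refl
  part-unique 0F 1F x∈ x∈′ = contradiction (_ , x∈p∩q⁺ (x∈ , x∈′)) disjoint₁₂
  part-unique 0F 2F x∈ x∈′ = contradiction (_ , x∈p∩q⁺ (x∈ , x∈′)) disjoint₁₃
  part-unique 1F 0F x∈ x∈′ = contradiction (_ , x∈p∩q⁺ (x∈′ , x∈)) disjoint₁₂
  part-unique 1F 1F _  _  = refl
  part-unique 1F 2F x∈ x∈′ = contradiction (_ , x∈p∩q⁺ (x∈ , x∈′)) disjoint₂₃
  part-unique 2F 0F x∈ x∈′ = contradiction (_ , x∈p∩q⁺ (x∈′ , x∈)) disjoint₁₃
  part-unique 2F 1F x∈ x∈′ = contradiction (_ , x∈p∩q⁺ (x∈′ , x∈)) disjoint₂₃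
  part-unique 2F 2F _  _  = refl

  part-cover : ∀ x → ∃[ j ] x ∈ part j
  part-cover x with x∈p∪q⁻ T₁ (T₂ ∪ T₃) (subst (x ∈_) (sym union) ∈⊤)
  ... | inj₁ x∈T₁ = 0F , x∈T₁
  ... | inj₂ x∈T₂∪T₃ with x∈p∪q⁻ T₂ T₃ x∈T₂∪T₃
  ...   | inj₁ x∈T₂ = 1F , x∈T₂
  ...   | inj₂ x∈T₃ = 2F , x∈T₃

  colour : Fin ∣U∣ → Fin 3
  colour x = proj₁ (part-cover x)

  ∈-colour : ∀ x → x ∈ part (colour x)
  ∈-colour x = proj₂ (part-cover x)

  colour-unique : ∀ {x} j → x ∈ part j → colour x ≡ j
  colour-unique j x∈ = part-unique _ j (∈-colour _) x∈

  class : ∀ x → ∃[ k ] x ∈ Ω k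
  class x = let k , x∈ , _ = partition x in k , x∈

  sameσ⇒∈Ω : ∀ {x y k} → σ x ≡ σ y → x ∈ Ω k → y ∈ Ω k
  sameσ⇒∈Ω {x} {y} {k} σx≡σy x∈Ωk with Equivalence.to (fibres x y) σx≡σy | partition x
  -- The class shared by `x` and `y` comes with its own index `l`, which uniqueness in the partition
  -- identifies with `k`.
  ... | l , x∈Ωl , y∈Ωl | _ , _ , unique = subst (λ k → y ∈ Ω k) (trans (sym (unique x∈Ωl)) (unique x∈Ωk)) y∈Ωl

  ∈Ω⇒sameσ : ∀ {x y k} → x ∈ Ω k → y ∈ Ω k → σ x ≡ σ y
  ∈Ω⇒sameσ x∈ y∈ = Equivalence.from (fibres _ _) (_ , x∈ , y∈)

  section : Fin n → Fin ∣U∣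
  section i = proj₁ (surjective i)

  σ-section : ∀ i → σ (section i) ≡ i
  σ-section i = proj₂ (surjective i) refl

  -- Skew classes are indexed independently of `σ`, so the class belonging to `i` is found through a
  -- preimage of `i`.
  transversal-meet : ∀ S → IsTransversal C S → ∀ i → ∃[ x ] (x ∈ S × σ x ≡ i)
  transversal-meet S trans-S i =
    let k , s∈Ωk = class (section i)
        x , x∈S , x∈Ωk = ∣p∩q∣≡1⇒meet S (Ω k) (trans-S k)
    in x , x∈S , trans (∈Ω⇒sameσ x∈Ωk s∈Ωk) (σ-section i)

  transversal-unique : ∀ S → IsTransversal C S → ∀ {x y} → x ∈ S → y ∈ S → σ x ≡ σ y → x ≡ y
  transversal-unique S trans-S {x} x∈S y∈S σx≡σy =
    let k , x∈Ωk = class x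
    in ∣p∩q∣≡1⇒unique S (Ω k) (trans-S k) x∈S x∈Ωk y∈S (sameσ⇒∈Ω σx≡σy x∈Ωk)

  -- Elements of equal colour lie in a common transversal, which meets their skew class only once.
  coordinates-injective : ∀ {x y} → σ x ≡ σ y → colour x ≡ colour y → x ≡ y
  coordinates-injective {x} {y} σx≡σy cx≡cy = transversal-unique (part (colour y)) (part-transversal (colour y))
    (subst (λ j → x ∈ part j) cx≡cy (∈-colour x)) (∈-colour y) σx≡σy

  coordinates-surjective : ∀ i s → ∃[ x ] (σ x ≡ i × colour x ≡ s)
  coordinates-surjective i s =
    let x , x∈ , σx≡i = transversal-meet (part s) (part-transversal s) i in x , σx≡i , colour-unique s x∈

  -- Encodes an arbitrary transversal by its colours; it is a basis of the lift of `D` exactly when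
  -- `extend D t` is true.
  basis : Vec (Fin 3) n → Subset ∣U∣
  basis t = tabulate λ x → does (colour x ≟ lookup t (σ x))

  ∈-basis⇔ : ∀ t {x} → x ∈ basis t ⇔ colour x ≡ lookup t (σ x)
  ∈-basis⇔ t = ∈-tabulate⇔ (λ x → colour x ≟ lookup t (σ x))

  basis-transversal : ∀ t → IsTransversal C (basis t)
  basis-transversal t k =
    -- `T₁` supplies some element of `Ω k`, whose `σ`-value tells which coordinate of `t` governs
    -- this class.
    let z , _ , z∈Ωk = ∣p∩q∣≡1⇒meet T₁ (Ω k) (transversal₁ k)
        x , σx≡σz , cx≡ = coordinates-surjective (σ z) (lookup t (σ z))
        x∈Ωk = sameσ⇒∈Ω (sym σx≡σz) z∈Ωk
        x∈basis = Equivalence.from (∈-basis⇔ t) (trans cx≡ (cong (lookup t) (sym σx≡σz)))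
        unique : ∀ {y} → y ∈ basis t ∩ Ω k → x ≡ y
        unique y∈ =
          let y∈basis , y∈Ωk = x∈p∩q⁻ (basis t) (Ω k) y∈
              σy≡σz = ∈Ω⇒sameσ y∈Ωk z∈Ωk
          in coordinates-injective (trans σx≡σz (sym σy≡σz))
               (trans cx≡ (trans (cong (lookup t) (sym σy≡σz)) (sym (Equivalence.to (∈-basis⇔ t) y∈basis))))
        is-singleton = ⊆-antisym (λ y∈ → subst (_∈ ⁅ x ⁆) (unique y∈) (x∈⁅x⁆ x))
          (λ y∈ → subst (_∈ basis t ∩ Ω k) (sym (x∈⁅y⁆⇒x≡y x y∈)) (x∈p∩q⁺ (x∈basis , x∈Ωk)))
    in trans (cong ∣_∣ is-singleton) (∣⁅x⁆∣≡1 x)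

  -- The vector records the colour of the unique representative of `B` over each `i`.
  transversal-basis : ∀ {B} → IsTransversal C B → ∃[ t ] B ≡ basis t
  transversal-basis {B} trans-B = t , ⊆-antisym (Equivalence.from (∈-basis⇔ t) ∘ colour-∈) from
    where
    rep : Fin n → Fin ∣U∣
    rep i = proj₁ (transversal-meet B trans-B i)
    rep∈B : ∀ i → rep i ∈ B
    rep∈B i = proj₁ (proj₂ (transversal-meet B trans-B i))
    σ-rep : ∀ i → σ (rep i) ≡ i
    σ-rep i = proj₂ (proj₂ (transversal-meet B trans-B i))
    t = tabulate (colour ∘ rep)
    colour-∈ : ∀ {x} → x ∈ B → colour x ≡ lookup t (σ x)
    colour-∈ {x} x∈B = trans
      (cong colour (transversal-unique B trans-B x∈B (rep∈B (σ x)) (sym (σ-rep (σ x)))))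
      (sym (lookup∘tabulate _ (σ x)))
    from : basis t ⊆ B
    from {x} x∈ = subst (_∈ B)
      (coordinates-injective (σ-rep (σ x))
        (sym (trans (Equivalence.to (∈-basis⇔ t) x∈) (lookup∘tabulate _ (σ x)))))
      (rep∈B (σ x))

  -- A transversal has exactly one element over each `i`, so none properly contains another. This
  -- recovers bases from independent sets.
  basis-⊆⇒≡ : ∀ t u → basis t ⊆ basis u → t ≡ u
  basis-⊆⇒≡ t u t⊆u = lookup-ext λ i → agree (coordinates-surjective i (lookup t i))
    where
    agree : ∀ {i} → ∃[ x ] (σ x ≡ i × colour x ≡ lookup t i) → lookup t i ≡ lookup u i
    agree (x , refl , cx≡) = trans (sym cx≡) (Equivalence.to (∈-basis⇔ u) (t⊆u (Equivalence.from (∈-basis⇔ t) cx≡)))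

  σ-basis∩part : ∀ t j → σ ⟦ basis t ∩ part j ⟧ ≡ level j t
  σ-basis∩part t j = ⊆-antisym
    (λ i∈ → Equivalence.from level⇔ (to (Equivalence.to (∈-image⇔ σ) i∈)))
    (λ i∈ → Equivalence.from (∈-image⇔ σ) (from (Equivalence.to level⇔ i∈)))
    where
    level⇔ : ∀ {i} → i ∈ level j t ⇔ lookup t i ≡ j
    level⇔ = ∈-tabulate⇔ (λ i → lookup t i ≟ j)
    to : ∀ {i} → ∃[ x ] (x ∈ basis t ∩ part j × σ x ≡ i) → lookup t i ≡ j
    to (x , x∈ , refl) = let x∈basis , x∈part = x∈p∩q⁻ (basis t) (part j) x∈ in
      trans (sym (Equivalence.to (∈-basis⇔ t) x∈basis)) (colour-unique j x∈part)
    from : ∀ {i} → lookup t i ≡ j → ∃[ x ] (x ∈ basis t ∩ part j × σ x ≡ i)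
    from {i} ti≡j = let x , σx≡i , cx≡j = coordinates-surjective i j in
      x , x∈p∩q⁺ ( Equivalence.from (∈-basis⇔ t) (trans cx≡j (trans (sym ti≡j) (cong (lookup t) (sym σx≡i))))
                 , subst (λ k → x ∈ part k) cx≡j (∈-colour x)) , σx≡i

  feasible-extend : ∀ D t → (D ∗̄ˢ (σ ⟦ basis t ∩ T₃ ⟧)) (σ ⟦ basis t ∩ T₂ ⟧) ≡ extend D t
  feasible-extend D t = trans
    (cong₂ (λ I X → (D ∗̄ˢ I) X) (σ-basis∩part t 2F) (σ-basis∩part t 1F)) (∗̄ˢ-extend D t)

  Z⇔ : ∀ D I → Z C D τ p I ⇔ (∃[ t ] (T (extend D t) × I ⊆ basis t))
  Z⇔ D I = mk⇔ to from
    where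
    to : Z C D τ p I → ∃[ t ] (T (extend D t) × I ⊆ basis t)
    to (B , (trans-B , feasible) , I⊆B) with transversal-basis {B} trans-B
    ... | t , refl = t , subst T (feasible-extend D t) feasible , I⊆B
    from : ∃[ t ] (T (extend D t) × I ⊆ basis t) → Z C D τ p I
    from (t , Dt , I⊆) = basis t , (basis-transversal t , subst T (sym (feasible-extend D t)) Dt) , I⊆

  -- The inclusion is tested on a full transversal: `basis t` must lie in a basis for `E`, and then
  -- equals it.
  Z-⊆⇒extend : ∀ {D E} → (∀ {I} → Z C D τ p I → Z C E τ p I) → ∀ t → T (extend D t) → T (extend E t)
  Z-⊆⇒extend {D} {E} Z⊆ t Dt =
    let u , Eu , t⊆u = Equivalence.to (Z⇔ E (basis t)) (Z⊆ (Equivalence.from (Z⇔ D (basis t)) (t , Dt , λ x∈ → x∈)))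
    in subst (T ∘ extend E) (sym (basis-⊆⇒≡ t u t⊆u)) Eu

  Z-injective : ∀ {D E} → Z C D τ p ≐ Z C E τ p → D ≗ E
  Z-injective {D} {E} (Z⊆ , Z⊇) = extend-injective λ t →
    does-⇔ (mk⇔ (Z-⊆⇒extend {D} {E} Z⊆ t) (Z-⊆⇒extend {E} {D} Z⊇ t)) (T? (extend D t)) (T? (extend E t))

-- Change of coordinates between two triples and projections.

module _ (C : Carrier n) (τ τ′ : TransversalTriple C) (p p′ : Projection C) where
  open Carrier C
  open Coordinates C τ p
  open Coordinates C τ′ p′ using () renaming
    (colour to colour′; basis to basis′; section to section′; σ-section to σ′-section;
     coordinates-injective to coordinates-injective′; coordinates-surjective to coordinates-surjective′; Z⇔ to Z⇔′)
  open Projection p using (σ; fibres)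
  open Projection p′ using () renaming (σ to σ′; fibres to fibres′)

  -- Labels go forward, from `σ` to `σ′`, but colours go back, from `colour′` to `colour`, because
  -- words act on extensions by precomposition.
  Compatible : 𝒢⋊S n → Set
  Compatible (ĝ , π) = (∀ x → σ′ x ≡ π ⟨$⟩ʳ σ x) × (∀ x → colour x ≡ permute (ĝ (σ′ x)) (colour′ x))

  basis-pull : ∀ γ → Compatible γ → ∀ t → basis′ t ≡ basis (pull γ t)
  basis-pull γ@(ĝ , π) (σ′≡ , colour≡) t = tabulate-cong λ x →
    does-⇔ (mk⇔ (to x) (from x)) (colour′ x ≟ lookup t (σ′ x)) (colour x ≟ lookup (pull γ t) (σ x))
    where
    pulled : ∀ x → lookup (pull γ t) (σ x) ≡ permute (ĝ (σ′ x)) (lookup t (σ′ x))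
    pulled x = trans (lookup-pull γ t (σ x)) (cong (λ i → permute (ĝ i) (lookup t i)) (sym (σ′≡ x)))
    to : ∀ x → colour′ x ≡ lookup t (σ′ x) → colour x ≡ lookup (pull γ t) (σ x)
    to x eq = trans (colour≡ x) (trans (cong (permute (ĝ (σ′ x))) eq) (sym (pulled x)))
    from : ∀ x → colour x ≡ lookup (pull γ t) (σ x) → colour′ x ≡ lookup t (σ′ x)
    from x eq = permute-injective (ĝ (σ′ x)) (trans (sym (colour≡ x)) (trans eq (pulled x)))

  -- The transversal with new coordinates `t` has old coordinates `pull γ t`, and the same
  -- substitution turns the extension of `D` into that of `γ • D`. Hence both lifts have the same
  -- bases.
  Z-• : ∀ γ → Compatible γ → ∀ {D D′} → D′ ≗ γ • D → Z C D′ τ′ p′ ≐ Z C D τ p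
  Z-• γ compatible {D} {D′} D′≗γD =
    (λ {I} ZI → let t , D′t , I⊆ = Equivalence.to (Z⇔′ D′ I) ZI in
      Equivalence.from (Z⇔ D I) (pull γ t , subst T (extended t) D′t , subst (I ⊆_) (basis-pull γ compatible t) I⊆))
    , (λ {I} ZI → let s , Ds , I⊆ = Equivalence.to (Z⇔ D I) ZI
                      t , pull≡s = pull-surjective γ s in
      Equivalence.from (Z⇔′ D′ I)
        ( t , subst T (trans (cong (extend D) (sym pull≡s)) (sym (extended t))) Ds
        , subst (I ⊆_) (trans (cong basis (sym pull≡s)) (sym (basis-pull γ compatible t))) I⊆))
    where
    extended : ∀ t → extend D′ t ≡ extend D (pull γ t)
    extended t = trans (extend-cong D′≗γD t) (extend-• γ D t)

  -- Both projections have the skew classes as fibres, so they differ by a permutation of the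
  -- labels. Within one class the two colourings differ by a permutation of three values, which some
  -- word realises.
  compatible-exists : ∃[ γ ] Compatible γ
  compatible-exists = ((λ i → proj₁ (word i)) , π) , σ′-π , colour-word
    where
    σ⇒σ′ : ∀ {x y} → σ x ≡ σ y → σ′ x ≡ σ′ y
    σ⇒σ′ = Equivalence.from (fibres′ _ _) ∘ Equivalence.to (fibres _ _)
    σ′⇒σ : ∀ {x y} → σ′ x ≡ σ′ y → σ x ≡ σ y
    σ′⇒σ = Equivalence.from (fibres _ _) ∘ Equivalence.to (fibres′ _ _)
    π : Permutation′ n
    π = permutation (σ′ ∘ section) (σ ∘ section′)
      (λ i → trans (σ⇒σ′ (σ-section _)) (σ′-section i))
      (λ i → trans (σ′⇒σ (σ′-section _)) (σ-section i))
    σ′-π : ∀ x → σ′ x ≡ π ⟨$⟩ʳ σ x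
    σ′-π x = σ⇒σ′ (sym (σ-section (σ x)))
    at : Fin n → Fin 3 → Fin ∣U∣
    at i s = proj₁ (coordinates-surjective′ i s)
    σ′-at : ∀ i s → σ′ (at i s) ≡ i
    σ′-at i s = proj₁ (proj₂ (coordinates-surjective′ i s))
    colour′-at : ∀ i s → colour′ (at i s) ≡ s
    colour′-at i s = proj₂ (proj₂ (coordinates-surjective′ i s))
    word : ∀ i → ∃[ g ] permute g ≗ colour ∘ at i
    -- Two elements of one class with the same old colour coincide, so their new colours agree.
    word i = permute-complete (colour ∘ at i) λ {s} {r} eq → begin
      s                 ≡⟨ colour′-at i s ⟨
      colour′ (at i s)  ≡⟨ cong colour′ (coordinates-injective (σ′⇒σ (trans (σ′-at i s) (sym (σ′-at i r)))) eq) ⟩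
      colour′ (at i r)  ≡⟨ colour′-at i r ⟩
      r                 ∎
    colour-word : ∀ x → colour x ≡ permute (proj₁ (word (σ′ x))) (colour′ x)
    colour-word x = trans
      (cong colour (sym (coordinates-injective′ (σ′-at (σ′ x) (colour′ x)) (colour′-at (σ′ x) (colour′ x)))))
      (sym (proj₂ (word (σ′ x)) (colour′ x)))

-- Realising every group element as a change of coordinates.

module _ (C : Carrier n) (τ : TransversalTriple C) (p : Projection C) (γ : 𝒢⋊S n) where
  open Coordinates C τ p
  open Projection p
  private
    ĝ = proj₁ γ
    π = proj₂ γ

    -- The old coordinates of the elements that are to receive new colour `j`, as `Compatible`
    -- prescribes.
    moved : Fin 3 → Vec (Fin 3) n
    moved j = tabulate λ i → permute (ĝ (π ⟨$⟩ʳ i)) j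

    ∈-moved⇔ : ∀ j {x} → x ∈ basis (moved j) ⇔ colour x ≡ permute (ĝ (π ⟨$⟩ʳ σ x)) j
    ∈-moved⇔ j {x} = mk⇔
      (λ x∈ → trans (Equivalence.to (∈-basis⇔ (moved j)) x∈) (lookup∘tabulate _ (σ x)))
      (λ eq → Equivalence.from (∈-basis⇔ (moved j)) (trans eq (sym (lookup∘tabulate _ (σ x)))))

    moved-disjoint : ∀ {i j} → i ≢ j → Empty (basis (moved i) ∩ basis (moved j))
    moved-disjoint {i} {j} i≢j (x , x∈) = let x∈i , x∈j = x∈p∩q⁻ _ (basis (moved j)) x∈ in
      i≢j (permute-injective (ĝ (π ⟨$⟩ʳ σ x))
        (trans (sym (Equivalence.to (∈-moved⇔ i) x∈i)) (Equivalence.to (∈-moved⇔ j) x∈j)))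

    moved-cover : ∀ x → x ∈ basis (moved 0F) ∪ basis (moved 1F) ∪ basis (moved 2F)
    moved-cover x with permute-surjective (ĝ (π ⟨$⟩ʳ σ x)) (colour x)
    ... | 0F , eq = x∈p∪q⁺ (inj₁ (Equivalence.from (∈-moved⇔ 0F) (sym eq)))
    ... | 1F , eq = x∈p∪q⁺ (inj₂ (x∈p∪q⁺ (inj₁ (Equivalence.from (∈-moved⇔ 1F) (sym eq)))))
    ... | 2F , eq = x∈p∪q⁺ (inj₂ (x∈p∪q⁺ (inj₂ (Equivalence.from (∈-moved⇔ 2F) (sym eq)))))

  movedTriple : TransversalTriple C
  movedTriple = record
    { T₁ = basis (moved 0F)
    ; T₂ = basis (moved 1F)
    ; T₃ = basis (moved 2F)
    ; transversal₁ = basis-transversal (moved 0F)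
    ; transversal₂ = basis-transversal (moved 1F)
    ; transversal₃ = basis-transversal (moved 2F)
    ; disjoint₁₂ = moved-disjoint λ ()
    ; disjoint₁₃ = moved-disjoint λ ()
    ; disjoint₂₃ = moved-disjoint λ ()
    ; union = ⊆-antisym ⊆⊤ (λ {x} _ → moved-cover x)
    }

  movedProjection : Projection C
  movedProjection = record
    { σ = (π ⟨$⟩ʳ_) ∘ σ
    ; surjective = λ i → section (π ⟨$⟩ˡ i) , λ { refl → trans (cong (π ⟨$⟩ʳ_) (σ-section (π ⟨$⟩ˡ i))) (inverseʳ π) }
    ; fibres = λ x y → mk⇔
        (λ eq → Equivalence.to (fibres x y) (trans (sym (inverseˡ π)) (trans (cong (π ⟨$⟩ˡ_) eq) (inverseˡ π))))
        (λ same → cong (π ⟨$⟩ʳ_) (Equivalence.from (fibres x y) same))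
    }

  moved-compatible : Compatible C τ movedTriple p movedProjection γ
  moved-compatible = (λ _ → refl) , (λ x → colour-moved (∈-colour′ x))
    where
    open Coordinates C movedTriple movedProjection using () renaming (part to part′; colour to colour′; ∈-colour to ∈-colour′)
    colour-moved : ∀ {x j} → x ∈ part′ j → colour x ≡ permute (ĝ (π ⟨$⟩ʳ σ x)) j
    colour-moved {j = 0F} = Equivalence.to (∈-moved⇔ 0F)
    colour-moved {j = 1F} = Equivalence.to (∈-moved⇔ 1F)
    colour-moved {j = 2F} = Equivalence.to (∈-moved⇔ 2F)

-- Orbits described by equality of lifts.

theorem5p5 : (n : ℕ) (D : SetSystem n) → VfSafe D →
    (C : Carrier n) (τ : TransversalTriple C) (p : Projection C) →
    Orb D ≐ (λ D′ → VfSafe D′ ×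
    (Σ[ τ′ ∈ TransversalTriple C ] Σ[ p′ ∈ Projection C ] (Z C D′ τ′ p′ ≐ Z C D τ p)))
theorem5p5 n D safe C τ p = (λ {D′} → to {D′}) , (λ {D′} → from {D′})
  where
  Liftable : SetSystem n → Set
  Liftable D′ = VfSafe D′ ×
    (Σ[ τ′ ∈ TransversalTriple C ] Σ[ p′ ∈ Projection C ] (Z C D′ τ′ p′ ≐ Z C D τ p))
  to : ∀ {D′} → Orb D D′ → Liftable D′
  -- The new triple and projection are chosen so that `γ` itself is the change of coordinates.
  to {D′} (γ , D′≗γD) = orbit-vfSafe {D = D} {D′} safe (γ , D′≗γD) ,
    movedTriple C τ p γ , movedProjection C τ p γ ,
    Z-• C τ (movedTriple C τ p γ) p (movedProjection C τ p γ) γ (moved-compatible C τ p γ) {D} {D′} D′≗γD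
  from : ∀ {D′} → Liftable D′ → Orb D D′
  from {D′} (_ , τ′ , p′ , Z⊆ , Z⊇) =
    -- In the coordinates `τ′`, `p′` both `D′` and `γ • D` have the lift of `D`, and in fixed
    -- coordinates a lift determines its set system.
    let γ , compatible = compatible-exists C τ τ′ p p′
        Zγ⊆ , Zγ⊇ = Z-• C τ τ′ p p′ γ compatible {D} {γ • D} (λ _ → refl)
    in γ , Coordinates.Z-injective C τ′ p′ {D′} {γ • D} ((Zγ⊇ ∘ Z⊆) , (Z⊇ ∘ Zγ⊆))
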